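{- Let $\mathcal{A}$ be a Sperner system over $\{1,\dots,n\}$, and assume that $n\ge 4$. If $\mathcal{A}$ is $1$-homogeneous or has exactly one block, then $\mathcal{A}$ is reconstructible.
   Context: A set system over a finite set $A$ (the ground set) is a set of subsets of $A$, called blocks; it is a Sperner system if no block is included in another. It is $k$-homogeneous if each of its blocks has cardinality $k$. Set systems $\mathcal A$ over $A$ and $\mathcal B$ over $B$ are isomorphic, $\mathcal A\equiv\mathcal B$, if there is a bijection $\sigma\colon A\to B$ with $\{\sigma(S):S\in\mathcal A\}=\mathcal B$. For a two-element subset $I$ of $A$, let $\theta_I$ be the equivalence relation on $A$ whose only nonsingleton class is $I$; for $S\subseteq A$ let $S_I=\{x/\theta_I:x\in S\}\subseteq A/\theta_I$; for a Sperner system $\mathcal A$ over $A$ let $\mathcal A_I=\{S_I:S\in\mathcal A\}$ and let $\mathcal A^*_I$ be the set of inclusion-minimal elements of $\mathcal A_I$, a Sperner system over $A/\theta_I$. The deck of $\mathcal A$ is the multiset of the isomorphism types of the systems $\mathcal A^*_I$, with $I$ ranging over all two-element subsets of $A$. A reconstruction of $\mathcal A$ is a Sperner system over a ground set of the same cardinality that has the same deck as $\mathcal A$; $\mathcal A$ is reconstructible if it is isomorphic to all of its reconstructions. -}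

module Defs where

open import Data.Fin.Properties using (≡-decSetoid)
open import Data.List.Base using (List; []; _∷_; _++_; map; filter; length; deduplicate; allFin)
open import Data.List.Membership.Propositional.Properties using (∈-allFin)
open import Data.List.Properties using (map-∘; map-id; map-cong)
open import Data.List.Relation.Unary.All using (All; all?)
open import Data.List.Relation.Unary.Any using (here; there)
import Data.List.Membership.DecSetoid as DecMembership
import Data.List.Membership.Setoid as Membership
import Data.List.Membership.Setoid.Properties as Membershipₚ
import Data.List.Relation.Binary.Permutation.Setoid as Permutation
import Data.List.Relation.Binary.Subset.DecSetoid as DecSubset
import Data.List.Relation.Binary.Subset.Setoid as Subset
open import Data.List.Relation.Unary.Enumerates.Setoid using (IsEnumeration)
open import Data.List.Relation.Unary.Unique.Setoid using (Unique)
open import Data.List.Relation.Unary.Unique.Propositional.Properties using (allFin⁺)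
open import Data.Nat.Base using (ℕ)
open import Data.Product.Base using (Σ; Σ-syntax; _×_; _,_)
open import Data.Sum.Base using (_⊎_; inj₁; inj₂)
open import Function.Base using (id)
open import Function.Bundles using (Inverse)
import Function.Construct.Composition as Composition
import Function.Construct.Identity as Identity
import Function.Construct.Symmetry as Symmetry
open import Level using (0ℓ; suc)
open import Relation.Binary.Bundles using (Setoid; DecSetoid)
open import Relation.Binary.PropositionalEquality as ≡ using (_≡_)
open import Relation.Nullary.Decidable using (Dec; _×-dec_; _⊎-dec_; _→-dec_)

-- Sets are setoids, so that A/θ is available as A with a coarser equality.
-- The decidable equality makes the constructive notions below agree with the
-- classical ones.

DSet : Set₁
DSet = DecSetoid 0ℓ 0ℓ

∣_∣ₛ : DSet → Setoid 0ℓ 0ℓ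
∣ A ∣ₛ = DecSetoid.setoid A

infix 4 _[_∈_] _[_⊆_]

_[_∈_] : (A : DSet) → DecSetoid.Carrier A → List (DecSetoid.Carrier A) → Set
A [ x ∈ S ] = Membership._∈_ ∣ A ∣ₛ x S

_[_⊆_] : (A : DSet) (S T : List (DecSetoid.Carrier A)) → Set
A [ S ⊆ T ] = Subset._⊆_ ∣ A ∣ₛ S T

-- The set of finite subsets of A: lists, with order and repetitions ignored.

𝒫 : DSet → DSet
𝒫 A = record
  { Carrier = List (DecSetoid.Carrier A)
  ; _≈_     = λ S T → A [ S ⊆ T ] × A [ T ⊆ S ]
  ; isDecEquivalence = record
    { isEquivalence = record
      { refl  = (λ x∈ → x∈) , (λ x∈ → x∈)
      ; sym   = λ (p , q) → q , p
      ; trans = λ (p , q) (p′ , q′) → (λ x∈ → p′ (p x∈)) , (λ x∈ → q (q′ x∈))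
      }
    ; _≟_ = λ S T → (S ⊆? T) ×-dec (T ⊆? S)
    }
  }
  where open DecSubset A using (_⊆?_)

card : (A : DSet) → DecSetoid.Carrier (𝒫 A) → ℕ
card A S = length (deduplicate (DecSetoid._≟_ A) S)

SetSystem : DSet → Set
SetSystem A = DecSetoid.Carrier (𝒫 (𝒫 A))

Sperner : (A : DSet) → SetSystem A → Set
Sperner A 𝒜 = ∀ {S T} → 𝒫 A [ S ∈ 𝒜 ] → 𝒫 A [ T ∈ 𝒜 ] →
  A [ S ⊆ T ] → DecSetoid._≈_ (𝒫 A) S T

Homogeneous : (A : DSet) → ℕ → SetSystem A → Set
Homogeneous A k 𝒜 = ∀ {S} → 𝒫 A [ S ∈ 𝒜 ] → card A S ≡ k

-- The types of systems over different ground sets are different, so a system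
-- is paired with its ground set in order to form the isomorphism types.

System : Set₁
System = Σ DSet SetSystem

infix 4 _≅_

_≅_ : System → System → Set
(A , 𝒜) ≅ (B , ℬ) = Σ[ σ ∈ Inverse ∣ A ∣ₛ ∣ B ∣ₛ ]
  DecSetoid._≈_ (𝒫 (𝒫 B)) (map (map (Inverse.to σ)) 𝒜) ℬ

module _ (A B : DSet) where
  open DecSetoid
  image-cong : (f : Carrier A → Carrier B) →
    (∀ {x y} → _≈_ A x y → _≈_ B (f x) (f y)) →
    ∀ {S T} → _≈_ (𝒫 A) S T → _≈_ (𝒫 B) (map f S) (map f T)
  image-cong f f-cong {S} {T} (p , q) = half p , half q
    where
    half : ∀ {S T} → A [ S ⊆ T ] → B [ map f S ⊆ map f T ]
    half S⊆T y∈ with x , x∈ , y≈ ← Membershipₚ.∈-map⁻ ∣ A ∣ₛ ∣ B ∣ₛ y∈ =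
      Membershipₚ.∈-resp-≈ ∣ B ∣ₛ (sym B y≈)
        (Membershipₚ.∈-map⁺ ∣ A ∣ₛ ∣ B ∣ₛ f-cong (S⊆T x∈))

module _ (A : DSet) where
  open DecSetoid

  map-pointwise : {X : Set} (f g : X → Carrier A) →
    (∀ x → _≈_ A (f x) (g x)) →
    ∀ xs → _≈_ (𝒫 A) (map f xs) (map g xs)
  map-pointwise f g f≈g xs = half f g f≈g xs , half g f (λ x → sym A (f≈g x)) xs
    where
    half : ∀ f g → (∀ x → _≈_ A (f x) (g x)) →
      ∀ xs → A [ map f xs ⊆ map g xs ]
    half f g f≈g (x ∷ xs) (here y≈)  = here (trans A y≈ (f≈g x))
    half f g f≈g (x ∷ xs) (there y∈) = there (half f g f≈g xs y∈)

image²-cong : (A B : DSet) (σ : Inverse ∣ A ∣ₛ ∣ B ∣ₛ) {𝒜 𝒜′ : SetSystem A} →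
  DecSetoid._≈_ (𝒫 (𝒫 A)) 𝒜 𝒜′ →
  DecSetoid._≈_ (𝒫 (𝒫 B)) (map (map (Inverse.to σ)) 𝒜) (map (map (Inverse.to σ)) 𝒜′)
image²-cong A B σ = image-cong (𝒫 A) (𝒫 B) (map (Inverse.to σ))
  (image-cong A B (Inverse.to σ) (Inverse.to-cong σ))

image²-id : (A : DSet) (f : DecSetoid.Carrier A → DecSetoid.Carrier A) →
  (∀ x → DecSetoid._≈_ A (f x) x) →
  (𝒜 : SetSystem A) → DecSetoid._≈_ (𝒫 (𝒫 A)) (map (map f) 𝒜) 𝒜
image²-id A f f≈id 𝒜 =
  ≡.subst (DecSetoid._≈_ (𝒫 (𝒫 A)) (map (map f) 𝒜)) (map-id 𝒜)
    (map-pointwise (𝒫 A) (map f) id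
      (λ S → ≡.subst (DecSetoid._≈_ (𝒫 A) (map f S)) (map-id S)
        (map-pointwise A f id f≈id S)) 𝒜)

image²-∘ : {X Y Z : Set} (g : Y → Z) (f : X → Y) (𝒜 : List (List X)) →
  map (map (λ x → g (f x))) 𝒜 ≡ map (map g) (map (map f) 𝒜)
image²-∘ g f 𝒜 = ≡.trans (map-cong map-∘ 𝒜) (map-∘ 𝒜)

≅-refl : ∀ {X} → X ≅ X
≅-refl {A , 𝒜} = Identity.inverse ∣ A ∣ₛ
  , image²-id A id (λ _ → DecSetoid.refl A) 𝒜

≅-sym : ∀ {X Y} → X ≅ Y → Y ≅ X
≅-sym {A , 𝒜} {B , ℬ} (σ , σ𝒜≈ℬ) = σ⁻¹ , 𝒫²A.trans
  (𝒫²A.sym (image²-cong B A σ⁻¹ σ𝒜≈ℬ))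
  (≡.subst (λ 𝒞 → 𝒞 𝒫²A.≈ 𝒜) (image²-∘ (Inverse.from σ) (Inverse.to σ) 𝒜)
    (image²-id A _ (Inverse.strictlyInverseʳ σ) 𝒜))
  where
  σ⁻¹ = Symmetry.inverse σ
  module 𝒫²A = DecSetoid (𝒫 (𝒫 A))

≅-trans : ∀ {X Y Z} → X ≅ Y → Y ≅ Z → X ≅ Z
≅-trans {A , 𝒜} {B , ℬ} {C , 𝒞} (σ , σ𝒜≈ℬ) (τ , τℬ≈𝒞) =
  Composition.inverse σ τ , 𝒫²C.trans
    (≡.subst (λ 𝒟 → 𝒟 𝒫²C.≈ map (map (Inverse.to τ)) ℬ)
      (≡.sym (image²-∘ (Inverse.to τ) (Inverse.to σ) 𝒜))
      (image²-cong B C τ σ𝒜≈ℬ))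
    τℬ≈𝒞
  where module 𝒫²C = DecSetoid (𝒫 (𝒫 C))

isoTypes : Setoid (suc 0ℓ) 0ℓ
isoTypes = record
  { Carrier = System
  ; _≈_     = _≅_
  ; isEquivalence = record
    { refl  = λ {X} → ≅-refl {X}
    ; sym   = λ {X} {Y} → ≅-sym {X} {Y}
    ; trans = λ {X} {Y} {Z} → ≅-trans {X} {Y} {Z}
    }
  }

module _ (A : DSet) (I : DecSetoid.Carrier (𝒫 A)) where
  open DecSetoid A

  θ : Carrier → Carrier → Set
  θ x y = x ≈ y ⊎ (A [ x ∈ I ] × A [ y ∈ I ])

  private
    resp : ∀ {x y} → x ≈ y → A [ x ∈ I ] → A [ y ∈ I ]
    resp = Membershipₚ.∈-resp-≈ ∣ A ∣ₛ

    θ-sym : ∀ {x y} → θ x y → θ y x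
    θ-sym (inj₁ x≈y)      = inj₁ (sym x≈y)
    θ-sym (inj₂ (x∈ , y∈)) = inj₂ (y∈ , x∈)

    θ-trans : ∀ {x y z} → θ x y → θ y z → θ x z
    θ-trans (inj₁ x≈y)       (inj₁ y≈z)       = inj₁ (trans x≈y y≈z)
    θ-trans (inj₁ x≈y)       (inj₂ (y∈ , z∈)) = inj₂ (resp (sym x≈y) y∈ , z∈)
    θ-trans (inj₂ (x∈ , y∈)) (inj₁ y≈z)       = inj₂ (x∈ , resp y≈z y∈)
    θ-trans (inj₂ (x∈ , _))  (inj₂ (_ , z∈))  = inj₂ (x∈ , z∈)

  Quotient : DSet
  Quotient = record
    { Carrier = Carrier
    ; _≈_     = θ
    ; isDecEquivalence = record
      { isEquivalence = record
        { refl = inj₁ refl ; sym = θ-sym ; trans = θ-trans }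
      ; _≟_ = λ x y → (x ≟ y) ⊎-dec ((x ∈? I) ×-dec (y ∈? I))
      }
    }
    where open DecMembership A using (_∈?_)

  -- The canonical projection x ↦ x/θ.
  proj : Carrier → DecSetoid.Carrier Quotient
  proj = id

  collapse : SetSystem A → SetSystem Quotient
  collapse 𝒜 = map (map proj) 𝒜

module _ (A : DSet) where

  Minimal : SetSystem A → DecSetoid.Carrier (𝒫 A) → Set
  Minimal 𝒜 S = All (λ T → A [ T ⊆ S ] → A [ S ⊆ T ]) 𝒜

  minimal? : ∀ 𝒜 S → Dec (Minimal 𝒜 S)
  minimal? 𝒜 S = all? (λ T → (T ⊆? S) →-dec (S ⊆? T)) 𝒜
    where open DecSubset A using (_⊆?_)

  minimals : SetSystem A → SetSystem A
  minimals 𝒜 = filter (minimal? 𝒜) 𝒜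

cardSystem : (A : DSet) → SetSystem A → DecSetoid.Carrier (𝒫 A) → System
cardSystem A 𝒜 I = Quotient A I , minimals (Quotient A I) (collapse A I 𝒜)

record FiniteSet : Set₁ where
  field
    set         : DSet
    elements    : List (DecSetoid.Carrier set)
    enumeration : IsEnumeration ∣ set ∣ₛ elements
    unique      : Unique ∣ set ∣ₛ elements

  size : ℕ
  size = length elements

open FiniteSet public using (set; size)

[1⋯_] : ℕ → FiniteSet
[1⋯ n ] = record
  { set         = ≡-decSetoid n
  ; elements    = allFin n
  ; enumeration = ∈-allFin
  ; unique      = allFin⁺ n
  }

pairs : {X : Set} → List X → List (List X)
pairs []       = []
pairs (x ∷ xs) = map (λ y → x ∷ y ∷ []) xs ++ pairs xs

-- As the enumeration of A has no repetitions, every two-element subset occurs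
-- exactly once.
twoElementSubsets : (A : FiniteSet) → List (DecSetoid.Carrier (𝒫 (set A)))
twoElementSubsets A = pairs (FiniteSet.elements A)

deck : (A : FiniteSet) → SetSystem (set A) → List System
deck A 𝒜 = map (cardSystem (set A) 𝒜) (twoElementSubsets A)

-- Decks are multisets of isomorphism types: lists up to permutation and
-- isomorphism of their entries.
SameDeck : (A B : FiniteSet) → SetSystem (set A) → SetSystem (set B) → Set₁
SameDeck A B 𝒜 ℬ = Permutation._↭_ isoTypes (deck A 𝒜) (deck B ℬ)

IsReconstruction : (A B : FiniteSet) → SetSystem (set A) → SetSystem (set B) → Set₁
IsReconstruction A B 𝒜 ℬ =
  Sperner (set B) ℬ × size B ≡ size A × SameDeck B A ℬ 𝒜

Reconstructible : (A : FiniteSet) → SetSystem (set A) → Set₁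
Reconstructible A 𝒜 = ∀ (B : FiniteSet) (ℬ : SetSystem (set B)) →
  IsReconstruction A B 𝒜 ℬ → (set A , 𝒜) ≅ (set B , ℬ)

{-# OPTIONS --safe #-}
-- Both kinds of system are of the form F U for a subset U of the ground set,
-- where F U is either {U} or {{x} : x ∈ U}, and each card of F U is F (U_I).
--
-- Recognition: let every card of a Sperner system ℬ have the form F W.
-- Singletons: a block with two elements t, u equals {t, u} by the card of
-- I = {t, u}, and the card of a pair disjoint from {t, u} excludes {t, u}.
-- One block: for each I some block M satisfies M_I ⊆ S_I for all blocks S, and
-- M = S whenever S contains or avoids I.  So if there are two blocks, each misses
-- at most one point, and a pair avoiding the points missed by two blocks lies in
-- both, which makes them equal.
--
-- Hence ℬ = F V, and it remains to read |U| off the deck.  |U_I| is |U| − 1 if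
-- I ⊆ U and |U| otherwise, so for n ≥ 4 the least and the greatest value of
-- |U_I| determine |U|, and no multiplicities are needed.
module Submission where

open import Defs
open import Data.Empty using (⊥-elim)
open import Data.Fin.Base using (Fin; zero; suc; toℕ)
open import Data.Fin.Properties using (injective⇒≤; toℕ<n)
open import Data.List.Base
  using (List; []; _∷_; [_]; _++_; map; filter; length; lookup; concat; deduplicate)
open import Data.List.Properties using (length-map; length-tabulate; map-∘; map-id; filter-all)
open import Data.List.Relation.Unary.All as All using (All; []; _∷_)
import Data.List.Relation.Unary.All.Properties as Allₚ
open import Data.List.Relation.Unary.Any as Any using (Any; here; there; index)
import Data.List.Relation.Unary.Any.Properties as Anyₚ
open import Data.List.Relation.Unary.AllPairs using ([]; _∷_)
import Data.List.Membership.DecSetoid as DecMembership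
import Data.List.Membership.Propositional as Prop
import Data.List.Membership.Propositional.Properties as Propₚ
import Data.List.Membership.Setoid as Membership
import Data.List.Membership.Setoid.Properties as Membershipₚ
import Data.List.Relation.Binary.Permutation.Setoid as Permutation
import Data.List.Relation.Binary.Permutation.Setoid.Properties as Permutationₚ
import Data.List.Relation.Binary.Subset.DecSetoid as DecSubset
import Data.List.Relation.Binary.Subset.Setoid.Properties as Subsetₚ
open import Data.List.Relation.Unary.Enumerates.Setoid using (IsEnumeration)
open import Data.List.Relation.Unary.Unique.Setoid using (Unique)
import Data.List.Relation.Unary.Unique.Setoid.Properties as Uniqueₚ
import Data.List.Relation.Unary.Unique.DecSetoid.Properties as DecUniqueₚ
open import Data.Nat.Base using (ℕ; zero; suc; _≤_; _<_; z≤n; s≤s)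
import Data.Nat.Properties as ℕ
open import Data.Product.Base using (∃-syntax; _×_; _,_; proj₁; proj₂)
open import Data.Sum.Base as Sum using (_⊎_; inj₁; inj₂; swap)
open import Function.Base using (id)
open import Function.Bundles using (Injection; Inverse)
open import Function.Properties.Inverse using (Inverse⇒Injection)
import Function.Construct.Composition as Composition
import Function.Construct.Symmetry as Symmetry
open import Level using (0ℓ)
open import Relation.Binary.Bundles using (Setoid; DecSetoid)
open import Relation.Binary.PropositionalEquality.Core as ≡ using (_≡_; refl)
import Relation.Binary.PropositionalEquality.Properties as ≡ₚ
open import Relation.Nullary.Decidable using (yes; no; ¬?; decidable-stable)
open import Relation.Nullary.Negation using (¬_; contradiction)

-- Counting in finite setoids

module _ (S : Setoid 0ℓ 0ℓ) where
  open Setoid S using (_≈_) renaming (sym to ≈-sym)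
  open Membership S using (_∈_)

  lookup-injective : ∀ {xs} → Unique S xs → ∀ {i j} →
    lookup xs i ≈ lookup xs j → i ≡ j
  lookup-injective (_ ∷ _)  {zero}  {zero}  _ = refl
  lookup-injective (x≉ ∷ _) {zero}  {suc j} p =
    contradiction p (All.lookup x≉ (Propₚ.∈-lookup j))
  lookup-injective (x≉ ∷ _) {suc i} {zero}  p =
    contradiction (≈-sym p) (All.lookup x≉ (Propₚ.∈-lookup i))
  lookup-injective (_ ∷ u)  {suc i} {suc j} p = ≡.cong suc (lookup-injective u p)

  -- Pigeonhole on positions: sending a position of `xs` to the position in `ys` of an equal entry
  -- is injective, because `xs` has no repetitions.
  unique-⊆-length : ∀ {xs ys} → Unique S xs → (∀ {x} → x ∈ xs → x ∈ ys) →
    length xs ≤ length ys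
  unique-⊆-length {xs} u xs⊆ys = injective⇒≤ {f = λ i → index (sub i)}
    (λ {i} {j} eq → lookup-injective u (Membershipₚ.index-injective S (sub i) (sub j) eq))
    where sub = λ i → xs⊆ys (Membershipₚ.∈-lookup S xs i)

module _ (A : DSet) where
  open DecSetoid A renaming (refl to ≈-refl; sym to ≈-sym; trans to ≈-trans)
  private module 𝒫A = DecSetoid (𝒫 A)

  open DecMembership A using (_∈?_)

  dedup-≈ : ∀ S → 𝒫A._≈_ (deduplicate _≟_ S) S
  dedup-≈ S = Membershipₚ.∈-deduplicate⁻ ∣ A ∣ₛ _≟_ S
            , Membershipₚ.∈-deduplicate⁺ ∣ A ∣ₛ _≟_ (λ y≈x z≈x → ≈-trans z≈x (≈-sym y≈x))

  dedup-unique : ∀ S → Unique ∣ A ∣ₛ (deduplicate _≟_ S)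
  dedup-unique = DecUniqueₚ.deduplicate-! A

  unique-⊆-card : ∀ {xs U} → Unique ∣ A ∣ₛ xs → A [ xs ⊆ U ] → length xs ≤ card A U
  unique-⊆-card {U = U} u xs⊆U =
    unique-⊆-length ∣ A ∣ₛ u (λ x∈ → proj₂ (dedup-≈ U) (xs⊆U x∈))

  card-⊆-length : ∀ {U ys} → A [ U ⊆ ys ] → card A U ≤ length ys
  card-⊆-length {U} U⊆ys =
    unique-⊆-length ∣ A ∣ₛ (dedup-unique U) (λ x∈ → U⊆ys (proj₁ (dedup-≈ U) x∈))

  card-mono : ∀ {U V} → A [ U ⊆ V ] → card A U ≤ card A V
  card-mono {U} U⊆V = unique-⊆-card (dedup-unique U) (λ x∈ → U⊆V (proj₁ (dedup-≈ U) x∈))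

  -- Membership is decidable, so `xs` can be searched for an entry outside `ys`; a failed search
  -- would give the inclusion.
  ⊈-witness : ∀ {xs ys} → ¬ A [ xs ⊆ ys ] → ∃[ x ] A [ x ∈ xs ] × ¬ A [ x ∈ ys ]
  ⊈-witness {xs} {ys} xs⊈ys with Any.any? (λ x → ¬? (x ∈? ys)) xs
  ... | yes x∉ = let x , x∈ , x∉ys = Prop.find x∉ in x , Any.map reflexive x∈ , x∉ys
  ... | no ¬x∉ = ⊥-elim (xs⊈ys xs⊆ys)
    where
    xs⊆ys : A [ xs ⊆ ys ]
    xs⊆ys x∈ = let z , z∈ , x≈z = Prop.find x∈ in
      Membershipₚ.∈-resp-≈ ∣ A ∣ₛ (≈-sym x≈z)
        (decidable-stable (z ∈? ys) (All.lookup (Allₚ.¬Any⇒All¬ xs ¬x∉) z∈))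

  card-≡-1 : ∀ S → card A S ≡ 1 → ∃[ x ] S 𝒫A.≈ [ x ]
  card-≡-1 S |S|≡1 with deduplicate _≟_ S | dedup-≈ S
  card-≡-1 S refl | x ∷ [] | x≈S = x , 𝒫A.sym x≈S

-- Injectivity of `σ` keeps the image of a deduplicated list free of repetitions, so its length
-- bounds `card B V` from below.
card-image-≤ : (A B : DSet) (σ : Inverse ∣ A ∣ₛ ∣ B ∣ₛ) → ∀ {U V} →
  B [ map (Inverse.to σ) U ⊆ V ] → card A U ≤ card B V
card-image-≤ A B σ {U} {V} σU⊆V = ≡.subst (_≤ card B V)
  (length-map (Inverse.to σ) (deduplicate (DecSetoid._≟_ A) U))
  (unique-⊆-card B
    (Uniqueₚ.map⁺ ∣ A ∣ₛ ∣ B ∣ₛ (Injection.injective (Inverse⇒Injection σ)) (dedup-unique A U))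
    (λ y∈ → σU⊆V (proj₁ (image-cong A B (Inverse.to σ) (Inverse.to-cong σ) (dedup-≈ A U)) y∈)))

≅-card : (A B : DSet) (σ : Inverse ∣ A ∣ₛ ∣ B ∣ₛ) → ∀ {U V} →
  DecSetoid._≈_ (𝒫 B) (map (Inverse.to σ) U) V → card A U ≡ card B V
≅-card A B σ {U} {V} (σU⊆V , V⊆σU) = ℕ.≤-antisym (card-image-≤ A B σ σU⊆V)
  (card-image-≤ B A (Symmetry.inverse σ) λ x∈ →
    let y , y∈ , x≈ = Membershipₚ.∈-map⁻ ∣ B ∣ₛ ∣ A ∣ₛ x∈
        z , z∈ , y≈ = Membershipₚ.∈-map⁻ ∣ A ∣ₛ ∣ B ∣ₛ (V⊆σU y∈)
    in Membershipₚ.∈-resp-≈ ∣ A ∣ₛ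
         (DecSetoid.sym A (DecSetoid.trans A x≈ (Inverse.inverseʳ σ y≈))) z∈)

-- Bijections that match two subsets of equal size

lookup-++ˡ : ∀ {X : Set} (xs ys : List X) i → toℕ i < length xs → lookup (xs ++ ys) i Prop.∈ xs
lookup-++ˡ (x ∷ xs) ys zero    _       = here refl
lookup-++ˡ (x ∷ xs) ys (suc i) (s≤s p) = there (lookup-++ˡ xs ys i p)

index-++⁺ˡ : ∀ {X : Set} {P : X → Set} {xs ys} (p : Any P xs) →
  toℕ (index (Anyₚ.++⁺ˡ {ys = ys} p)) ≡ toℕ (index p)
index-++⁺ˡ (here _)  = refl
index-++⁺ˡ (there p) = ≡.cong suc (index-++⁺ˡ p)

module _ (S : Setoid 0ℓ 0ℓ) where
  open Setoid S using (Carrier; _≈_) renaming (sym to ≈-sym; trans to ≈-trans)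
  open Membership S using (_∈_)

  -- The length is equated with a variable `n` so that enumerations of two different setoids can be
  -- numbered by the same `Fin n` and then composed.
  indexing : ∀ {xs n} → IsEnumeration S xs → Unique S xs → length xs ≡ n →
    Inverse S (≡ₚ.setoid (Fin n))
  indexing {xs} enum unique refl = record
    { to        = λ x → index (enum x)
    ; from      = lookup xs
    ; to-cong   = λ {x} {y} x≈y → lookup-injective S unique
        (≈-trans (≈-sym (at x)) (≈-trans x≈y (at y)))
    ; from-cong = λ { refl → Setoid.refl S }
    ; inverse   = (λ {i} {x} x≈ → lookup-injective S unique (≈-trans (≈-sym (at x)) x≈))
                , (λ { {x} refl → ≈-sym (at x) })
    }
    where
    at : ∀ x → x ≈ lookup xs (index (enum x))
    at x = Anyₚ.lookup-index (enum x)

  module _ {xs ys : List Carrier} {n : ℕ}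
           (enum : IsEnumeration S (xs ++ ys)) (unique : Unique S (xs ++ ys)) where

    ∈⇒index< : (eq : length (xs ++ ys) ≡ n) → ∀ {x} → x ∈ xs →
      toℕ (Inverse.to (indexing enum unique eq) x) < length xs
    ∈⇒index< refl {x} x∈ = ≡.subst (_< length xs) (≡.sym same) (toℕ<n (index x∈))
      where
      -- Without repetitions, the position found by `enum` is the one that `x∈` gives in the first
      -- part of the list.
      same : toℕ (index (enum x)) ≡ toℕ (index x∈)
      same = ≡.trans
        (≡.cong toℕ (lookup-injective S unique (≈-trans (≈-sym (Anyₚ.lookup-index (enum x)))
          (Anyₚ.lookup-index (Anyₚ.++⁺ˡ {ys = ys} x∈)))))
        (index-++⁺ˡ x∈)

    index<⇒∈ : (eq : length (xs ++ ys) ≡ n) → ∀ {x} →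
      toℕ (Inverse.to (indexing enum unique eq) x) < length xs → x ∈ xs
    index<⇒∈ refl {x} p = Membershipₚ.∈-resp-≈ S (≈-sym (Anyₚ.lookup-index (enum x)))
      (Any.map (Setoid.reflexive S) (lookup-++ˡ xs ys (index (enum x)) p))

module _ (A : FiniteSet) (U : List (DecSetoid.Carrier (set A))) where
  open DecSetoid (set A) using (_≈_; _≟_) renaming (sym to ≈-sym; trans to ≈-trans)
  open FiniteSet A using (elements; enumeration; unique)
  open DecMembership (set A) using (_∈?_)
  private S = ∣ set A ∣ₛ

  complement : List (DecSetoid.Carrier (set A))
  complement = filter (λ x → ¬? (x ∈? U)) elements

  private
    ∉-resp : ∀ {x y} → x ≈ y → ¬ set A [ x ∈ U ] → ¬ set A [ y ∈ U ]
    ∉-resp x≈y x∉ y∈ = x∉ (Membershipₚ.∈-resp-≈ S (≈-sym x≈y) y∈)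

  -- Listing `U` first turns membership in `U` into a condition on positions: being below
  -- `card (set A) U`.
  split : List (DecSetoid.Carrier (set A))
  split = deduplicate _≟_ U ++ complement

  split-unique : Unique S split
  split-unique = Uniqueₚ.++⁺ S (dedup-unique (set A) U) (Uniqueₚ.filter⁺ S _ unique)
    λ (x∈ , x∉) → proj₂ (Membershipₚ.∈-filter⁻ S (λ x → ¬? (x ∈? U)) ∉-resp {xs = elements} x∉)
      (proj₁ (dedup-≈ (set A) U) x∈)

  split-enumeration : IsEnumeration S split
  split-enumeration x with x ∈? U
  ... | yes x∈ = Membershipₚ.∈-++⁺ˡ S (proj₂ (dedup-≈ (set A) U) x∈)
  ... | no  x∉ = Membershipₚ.∈-++⁺ʳ S (deduplicate _≟_ U)
    (Membershipₚ.∈-filter⁺ S (λ x → ¬? (x ∈? U)) ∉-resp (enumeration x) x∉)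

  split-length : length split ≡ size A
  split-length = ℕ.≤-antisym
    (unique-⊆-length S split-unique (λ _ → enumeration _))
    (unique-⊆-length S unique (λ _ → split-enumeration _))

module _ (A B : FiniteSet) (|A|≡|B| : size A ≡ size B)
         {U : List (DecSetoid.Carrier (set A))} {V : List (DecSetoid.Carrier (set B))}
         (|U|≡|V| : card (set A) U ≡ card (set B) V) where
  private
    module B = DecSetoid (set B)
    |split|≡|B| = ≡.trans (split-length A U) |A|≡|B|
    ι = indexing ∣ set A ∣ₛ (split-enumeration A U) (split-unique A U) |split|≡|B|
    κ = indexing ∣ set B ∣ₛ (split-enumeration B V) (split-unique B V) (split-length B V)

  -- Matches equal positions in the two `split` lists. As `U` and `V` fill initial segments of the
  -- same length, `U` is carried onto `V`.
  extend : Inverse ∣ set A ∣ₛ ∣ set B ∣ₛ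
  extend = Composition.inverse ι (Symmetry.inverse κ)

  private
    open Inverse extend using (to; from; to-cong; strictlyInverseˡ)

    κ∘to : ∀ x → Inverse.to κ (to x) ≡ Inverse.to ι x
    κ∘to x = Inverse.strictlyInverseˡ κ (Inverse.to ι x)

    to-∈ : ∀ {x} → set A [ x ∈ U ] → set B [ to x ∈ V ]
    to-∈ {x} x∈ = proj₁ (dedup-≈ (set B) V)
      (index<⇒∈ ∣ set B ∣ₛ (split-enumeration B V) (split-unique B V) (split-length B V)
        (≡.subst₂ (λ i k → toℕ i < k) (≡.sym (κ∘to x)) |U|≡|V|
          (∈⇒index< ∣ set A ∣ₛ (split-enumeration A U) (split-unique A U) |split|≡|B|
            (proj₂ (dedup-≈ (set A) U) x∈))))

    to-∈⁻ : ∀ {x} → set B [ to x ∈ V ] → set A [ x ∈ U ]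
    to-∈⁻ {x} x∈ = proj₁ (dedup-≈ (set A) U)
      (index<⇒∈ ∣ set A ∣ₛ (split-enumeration A U) (split-unique A U) |split|≡|B|
        (≡.subst₂ (λ i k → toℕ i < k) (κ∘to x) (≡.sym |U|≡|V|)
          (∈⇒index< ∣ set B ∣ₛ (split-enumeration B V) (split-unique B V) (split-length B V)
            (proj₂ (dedup-≈ (set B) V) x∈))))

  extend-image : DecSetoid._≈_ (𝒫 (set B)) (map to U) V
  extend-image = image⊆ , ⊆image
    where
    image⊆ : set B [ map to U ⊆ V ]
    image⊆ y∈ with x , x∈ , y≈ ← Membershipₚ.∈-map⁻ ∣ set A ∣ₛ ∣ set B ∣ₛ y∈ =
      Membershipₚ.∈-resp-≈ ∣ set B ∣ₛ (B.sym y≈) (to-∈ x∈)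

    ⊆image : set B [ V ⊆ map to U ]
    ⊆image {y} y∈ = Membershipₚ.∈-resp-≈ ∣ set B ∣ₛ (strictlyInverseˡ y)
      (Membershipₚ.∈-map⁺ ∣ set A ∣ₛ ∣ set B ∣ₛ to-cong
        (to-∈⁻ (Membershipₚ.∈-resp-≈ ∣ set B ∣ₛ (B.sym (strictlyInverseˡ y)) y∈)))

-- Pairs and quotients

-- A list in `pairs` fixes an order and representatives of its two points. This record depends on
-- neither, so a pair can be named by any two distinct points.
record IsPair (A : DSet) (I : List (DecSetoid.Carrier A)) (i j : DecSetoid.Carrier A) : Set where
  open DecSetoid A using (_≈_)
  field
    distinct : ¬ i ≈ j
    left∈    : A [ i ∈ I ]
    right∈   : A [ j ∈ I ]
    only     : ∀ {x} → A [ x ∈ I ] → x ≈ i ⊎ x ≈ j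

module _ (A : DSet) where
  open DecSetoid A renaming (refl to ≈-refl; sym to ≈-sym; trans to ≈-trans)

  isPair : ∀ {i j} → ¬ i ≈ j → IsPair A (i ∷ j ∷ []) i j
  isPair i≉j = record
    { distinct = i≉j
    ; left∈    = here ≈-refl
    ; right∈   = there (here ≈-refl)
    ; only     = λ { (here x≈i) → inj₁ x≈i ; (there (here x≈j)) → inj₂ x≈j }
    }

  isPair-swap : ∀ {I i j} → IsPair A I i j → IsPair A I j i
  isPair-swap p = record
    { distinct = λ j≈i → distinct (≈-sym j≈i)
    ; left∈    = right∈
    ; right∈   = left∈
    ; only     = λ x∈ → swap (only x∈)
    }
    where open IsPair p

  isPair-resp : ∀ {I i j i′ j′} → i ≈ i′ → j ≈ j′ → IsPair A I i j → IsPair A I i′ j′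
  isPair-resp {I} i≈ j≈ p = record
    { distinct = λ i′≈j′ → distinct (≈-trans i≈ (≈-trans i′≈j′ (≈-sym j≈)))
    ; left∈    = Membershipₚ.∈-resp-≈ ∣ A ∣ₛ i≈ left∈
    ; right∈   = Membershipₚ.∈-resp-≈ ∣ A ∣ₛ j≈ right∈
    ; only     = λ x∈ → Sum.map (λ x≈ → ≈-trans x≈ i≈) (λ x≈ → ≈-trans x≈ j≈) (only x∈)
    }
    where open IsPair p

  ∈-pairs⁻ : ∀ {xs I} → Unique ∣ A ∣ₛ xs → I Prop.∈ pairs xs → ∃[ i ] ∃[ j ] IsPair A I i j
  ∈-pairs⁻ {x ∷ xs} (x≉ ∷ u) I∈ with Propₚ.∈-++⁻ (map (λ y → x ∷ y ∷ []) xs) I∈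
  ... | inj₂ I∈′ = ∈-pairs⁻ u I∈′
  ... | inj₁ I∈′ with y , y∈ , refl ← Propₚ.∈-map⁻ (λ y → x ∷ y ∷ []) I∈′ =
    x , y , isPair (All.lookup x≉ y∈)

∈-pairs⁺ : ∀ {X : Set} {xs : List X} {x y} → x Prop.∈ xs → y Prop.∈ xs → ¬ x ≡ y →
  (x ∷ y ∷ []) Prop.∈ pairs xs ⊎ (y ∷ x ∷ []) Prop.∈ pairs xs
∈-pairs⁺ (here refl) (here refl) x≢y = contradiction refl x≢y
∈-pairs⁺ (here refl) (there y∈)  x≢y = inj₁ (Propₚ.∈-++⁺ˡ (Propₚ.∈-map⁺ _ y∈))
∈-pairs⁺ (there x∈)  (here refl) x≢y = inj₂ (Propₚ.∈-++⁺ˡ (Propₚ.∈-map⁺ _ x∈))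
∈-pairs⁺ (there x∈)  (there y∈)  x≢y =
  Sum.map (Propₚ.∈-++⁺ʳ _) (Propₚ.∈-++⁺ʳ _) (∈-pairs⁺ x∈ y∈ x≢y)

module _ (A : FiniteSet) where
  open DecSetoid (set A) using (_≈_; reflexive) renaming (sym to ≈-sym; trans to ≈-trans)
  open FiniteSet A using (elements; enumeration; unique)

  pair-of : ∀ {x y} → ¬ x ≈ y → ∃[ I ] I Prop.∈ twoElementSubsets A × IsPair (set A) I x y
  pair-of {x} {y} x≉y
    -- Listed pairs consist of entries of `elements`, so `x` and `y` are first replaced by the
    -- entries equal to them.
    with x′ , x′∈ , x≈x′ ← Prop.find (enumeration x)
       | y′ , y′∈ , y≈y′ ← Prop.find (enumeration y)
    with x′≉y′ ← (λ (x′≈y′ : x′ ≈ y′) → x≉y (≈-trans x≈x′ (≈-trans x′≈y′ (≈-sym y≈y′))))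
    with ∈-pairs⁺ x′∈ y′∈ (λ x′≡y′ → x′≉y′ (reflexive x′≡y′))
  ... | inj₁ I∈ = _ , I∈ ,
    isPair-resp (set A) (≈-sym x≈x′) (≈-sym y≈y′) (isPair (set A) x′≉y′)
  ... | inj₂ I∈ = _ , I∈ ,
    isPair-resp (set A) (≈-sym x≈x′) (≈-sym y≈y′)
      (isPair-swap (set A) (isPair (set A) (λ y′≈x′ → x′≉y′ (≈-sym y′≈x′))))

  ∈-twoElementSubsets⁻ : ∀ {I} → I Prop.∈ twoElementSubsets A → ∃[ i ] ∃[ j ] IsPair (set A) I i j
  ∈-twoElementSubsets⁻ = ∈-pairs⁻ (set A) unique

  -- Pigeonhole: a list shorter than the enumeration cannot cover it. All auxiliary points chosen
  -- below come from here.
  outside : ∀ ys → length ys < size A → ∃[ x ] ¬ set A [ x ∈ ys ]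
  outside ys |ys|<|A| = let x , _ , x∉ = ⊈-witness (set A) elements⊈ys in x , x∉
    where
    elements⊈ys : ¬ set A [ elements ⊆ ys ]
    elements⊈ys elements⊆ys =
      ℕ.<⇒≱ |ys|<|A| (unique-⊆-length ∣ set A ∣ₛ unique (λ x∈ → elements⊆ys x∈))

module _ (A : DSet) {I : List (DecSetoid.Carrier A)} where
  open DecSetoid A renaming (refl to ≈-refl; sym to ≈-sym; trans to ≈-trans)
  private Q = Quotient A I

  project-∈ : ∀ {x S} → A [ x ∈ S ] → Q [ x ∈ S ]
  project-∈ = Any.map inj₁

  ∈-quotient⁻ : ∀ {x S} → Q [ x ∈ S ] → ∃[ y ] A [ y ∈ S ] × θ A I x y
  ∈-quotient⁻ x∈ = let y , y∈ , x~y = Prop.find x∈ in y , Any.map reflexive y∈ , x~y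

  -- The hypothesis holds if I is contained in T or disjoint from S or from T.
  lift-⊆ : ∀ {S T} →
    (∀ {s t} → A [ s ∈ S ] → A [ s ∈ I ] → A [ t ∈ T ] → A [ t ∈ I ] → A [ s ∈ T ]) →
    Q [ S ⊆ T ] → A [ S ⊆ T ]
  lift-⊆ h S⊆T s∈ with ∈-quotient⁻ (S⊆T (project-∈ s∈))
  ... | t , t∈ , inj₁ s≈t          = Membershipₚ.∈-resp-≈ ∣ A ∣ₛ (≈-sym s≈t) t∈
  ... | t , t∈ , inj₂ (s∈I , t∈I) = h s∈ s∈I t∈ t∈I

  card-quotient-≤ : ∀ U → card Q U ≤ card A U
  card-quotient-≤ U = card-⊆-length Q λ x∈ →
    let y , y∈ , x~y = ∈-quotient⁻ x∈ in
    Membershipₚ.∈-resp-≈ ∣ Q ∣ₛ (DecSetoid.sym Q x~y) (project-∈ (proj₂ (dedup-≈ A U) y∈))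

  module _ {i j} (I-pair : IsPair A I i j) where
    open IsPair I-pair

    -- Between elements of `U` the relation `θ` is plain equality, since it could only identify `i`
    -- with `j`. Hence deduplicating modulo `θ` loses nothing.
    ≤-card-quotient : ∀ U → ¬ (A [ i ∈ U ] × A [ j ∈ U ]) → card A U ≤ card Q U
    ≤-card-quotient U ¬i∧j = card-⊆-length A U⊆D
      where
      D = deduplicate (DecSetoid._≟_ Q) U

      U⊆D : A [ U ⊆ D ]
      U⊆D {x} x∈ with ∈-quotient⁻ (proj₂ (dedup-≈ Q U) (project-∈ x∈))
      ... | y , y∈ , x~y = Membershipₚ.∈-resp-≈ ∣ A ∣ₛ (≈-sym (θ⇒≈ x~y)) y∈
        where
        y∈U = Membershipₚ.∈-deduplicate⁻ ∣ A ∣ₛ (DecSetoid._≟_ Q) U y∈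

        in-U : ∀ {z w} → z ≈ w → A [ z ∈ U ] → A [ w ∈ U ]
        in-U = Membershipₚ.∈-resp-≈ ∣ A ∣ₛ

        θ⇒≈ : θ A I x y → x ≈ y
        θ⇒≈ (inj₁ x≈y) = x≈y
        θ⇒≈ (inj₂ (x∈I , y∈I)) with only x∈I | only y∈I
        ... | inj₁ x≈i | inj₁ y≈i = ≈-trans x≈i (≈-sym y≈i)
        ... | inj₂ x≈j | inj₂ y≈j = ≈-trans x≈j (≈-sym y≈j)
        ... | inj₁ x≈i | inj₂ y≈j = contradiction (in-U x≈i x∈ , in-U y≈j y∈U) ¬i∧j
        ... | inj₂ x≈j | inj₁ y≈i = contradiction (in-U y≈i y∈U , in-U x≈j x∈) ¬i∧j

    private
      ≉i? = λ x → ¬? (x ≟ i)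

      ≉i-resp : ∀ {x y} → x ≈ y → ¬ x ≈ i → ¬ y ≈ i
      ≉i-resp x≈y x≉i y≈i = x≉i (≈-trans x≈y y≈i)

      remove = filter ≉i?

      ∈-remove⁺ : ∀ {U x} → A [ x ∈ U ] → ¬ x ≈ i → A [ x ∈ remove U ]
      ∈-remove⁺ = Membershipₚ.∈-filter⁺ ∣ A ∣ₛ ≉i? ≉i-resp

      ∈-remove⁻ : ∀ {U x} → A [ x ∈ remove U ] → A [ x ∈ U ] × ¬ x ≈ i
      ∈-remove⁻ = Membershipₚ.∈-filter⁻ ∣ A ∣ₛ ≉i? ≉i-resp

    -- Without `i` the set no longer contains both points of `I`, so the previous bound applies to
    -- it; putting `i` back costs at most one.
    card-≤-suc-card-quotient : ∀ U → card A U ≤ suc (card Q U)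
    card-≤-suc-card-quotient U = ℕ.≤-trans
      (card-⊆-length A {ys = i ∷ deduplicate _≟_ (remove U)} cover)
      (s≤s (ℕ.≤-trans
        (≤-card-quotient (remove U) (λ (i∈ , _) → proj₂ (∈-remove⁻ {U} i∈) ≈-refl))
        (card-mono Q remove⊆)))
      where
      cover : A [ U ⊆ i ∷ deduplicate _≟_ (remove U) ]
      cover {x} x∈ with x ≟ i
      ... | yes x≈i = here x≈i
      ... | no  x≉i = there (proj₂ (dedup-≈ A (remove U)) (∈-remove⁺ x∈ x≉i))

      remove⊆ : Q [ remove U ⊆ U ]
      remove⊆ x∈ = let y , y∈ , x~y = ∈-quotient⁻ x∈ in
        Membershipₚ.∈-resp-≈ ∣ Q ∣ₛ (DecSetoid.sym Q x~y) (project-∈ (proj₁ (∈-remove⁻ y∈)))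

    -- Modulo `θ` the set `U` is still covered after removing `i`, while in `A` the removed `i`
    -- counts as one more element.
    suc-card-quotient-≤-card : ∀ {U} → A [ i ∈ U ] → A [ j ∈ U ] → suc (card Q U) ≤ card A U
    suc-card-quotient-≤-card {U} i∈ j∈ = ℕ.≤-trans
      (s≤s (ℕ.≤-trans (card-mono Q ⊆remove) (card-quotient-≤ (remove U))))
      (unique-⊆-card A {xs = i ∷ deduplicate _≟_ (remove U)}
        (Membershipₚ.∉⇒All[≉] ∣ A ∣ₛ
          (λ i∈ → proj₂ (∈-remove⁻ {U} (proj₁ (dedup-≈ A (remove U)) i∈)) ≈-refl)
          ∷ dedup-unique A (remove U))
        λ { (here x≈i) → Membershipₚ.∈-resp-≈ ∣ A ∣ₛ (≈-sym x≈i) i∈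
          ; (there x∈) → proj₁ (∈-remove⁻ (proj₁ (dedup-≈ A (remove U)) x∈)) })
      where
      ⊆remove : Q [ U ⊆ remove U ]
      ⊆remove {x} x∈ with ∈-quotient⁻ x∈
      ... | y , y∈ , x~y with y ≟ i
      ... | no  y≉i = Membershipₚ.∈-resp-≈ ∣ Q ∣ₛ (DecSetoid.sym Q x~y)
                        (project-∈ (∈-remove⁺ y∈ y≉i))
      -- The class of the removed point `i` is still represented by `j`.
      ... | yes y≈i = Membershipₚ.∈-resp-≈ ∣ Q ∣ₛ
        (DecSetoid.sym Q (DecSetoid.trans Q x~y
          (DecSetoid.trans Q (inj₁ y≈i) (inj₂ (left∈ , right∈)))))
        (project-∈ (∈-remove⁺ j∈ (λ j≈i → distinct (≈-sym j≈i))))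

-- Reading the size of the subset off the cards

module _ (A B : FiniteSet)
         {U : List (DecSetoid.Carrier (set A))} {V : List (DecSetoid.Carrier (set B))} where
  private
    module A = DecSetoid (set A)
    module B = DecSetoid (set B)

  -- Let |U| < |V|.  If V is not everything, some |V_J| is |V|, which exceeds every
  -- |U_I|.  Otherwise |V| ≥ 4 and every |V_J| ≥ |V| − 1, so |U| ≥ 2, and a pair
  -- I ⊆ U gives |U_I| = |U| − 1 < |V| − 1.
  card-≮ : 4 ≤ size B →
    (∀ {I} → I Prop.∈ twoElementSubsets A → ∃[ J ] J Prop.∈ twoElementSubsets B ×
      card (Quotient (set A) I) U ≡ card (Quotient (set B) J) V) →
    (∀ {J} → J Prop.∈ twoElementSubsets B → ∃[ I ] I Prop.∈ twoElementSubsets A ×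
      card (Quotient (set A) I) U ≡ card (Quotient (set B) J) V) →
    ¬ card (set A) U < card (set B) V
  card-≮ 4≤|B| A→B B→A |U|<|V| with card (set B) V ℕ.<? size B
  ... | yes |V|<|B| =
    let x , x∉ = outside B (deduplicate B._≟_ V) |V|<|B|
        y , y∉ = outside B [ x ] (ℕ.≤-trans (s≤s (s≤s z≤n)) 4≤|B|)
        J , J∈ , J-pair = pair-of B (λ x≈y → y∉ (here (B.sym x≈y)))
        I , I∈ , eq = B→A J∈
    in ℕ.<⇒≱ |U|<|V| (ℕ.≤-trans
      (≤-card-quotient (set B) J-pair V (λ (x∈ , _) → x∉ (proj₂ (dedup-≈ (set B) V) x∈)))
      (ℕ.≤-trans (ℕ.≤-reflexive (≡.sym eq)) (card-quotient-≤ (set A) U)))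
  ... | no |V|≮|B| = ℕ.<⇒≱ |U|<|V| (|V|≤|U| 1<|U|)
    where
    4≤|V| = ℕ.≤-trans 4≤|B| (ℕ.≮⇒≥ |V|≮|B|)

    1<|U| : 1 < card (set A) U
    1<|U| =
      let x , _ = outside B [] (ℕ.≤-trans (s≤s z≤n) 4≤|B|)
          y , y∉ = outside B [ x ] (ℕ.≤-trans (s≤s (s≤s z≤n)) 4≤|B|)
          J , J∈ , J-pair = pair-of B (λ x≈y → y∉ (here (B.sym x≈y)))
          I , I∈ , eq = B→A J∈
      in ℕ.≤-pred (ℕ.≤-trans (ℕ.≤-trans (s≤s (s≤s (s≤s z≤n))) 4≤|V|)
        (ℕ.≤-trans (card-≤-suc-card-quotient (set B) J-pair V)
          (s≤s (ℕ.≤-trans (ℕ.≤-reflexive (≡.sym eq)) (card-quotient-≤ (set A) U)))))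

    two-elements : ∀ {xs} → Unique ∣ set A ∣ₛ xs → 1 < length xs →
      ∃[ i ] ∃[ j ] ¬ i A.≈ j × i Prop.∈ xs × j Prop.∈ xs
    two-elements {i ∷ j ∷ _} ((i≉j ∷ _) ∷ _) _ = i , j , i≉j , here refl , there (here refl)
    two-elements {i ∷ []} _ (s≤s ())

    |V|≤|U| : 1 < card (set A) U → card (set B) V ≤ card (set A) U
    |V|≤|U| 1<|U| =
      let i , j , i≉j , i∈ , j∈ = two-elements (dedup-unique (set A) U) 1<|U|
          I , I∈ , I-pair = pair-of A i≉j
          J , J∈ , eq = A→B I∈
          _ , _ , J-pair = ∈-twoElementSubsets⁻ B J∈
          ∈U = λ {x} (x∈ : x Prop.∈ _) → proj₁ (dedup-≈ (set A) U) (Any.map A.reflexive x∈)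
      in ℕ.≤-trans (card-≤-suc-card-quotient (set B) J-pair V)
        (ℕ.≤-trans (s≤s (ℕ.≤-reflexive (≡.sym eq)))
          (suc-card-quotient-≤-card (set A) I-pair (∈U i∈) (∈U j∈)))

-- Minimal blocks

module _ (A : DSet) where
  open DecSubset A using (_⊆?_)
  private module 𝒫A = DecSetoid (𝒫 A)

  -- Induction on `𝒜` with `T` as first candidate: a new `S` replaces the candidate `M` only if `S`
  -- lies in `M`, and then everything inside `S` is also inside `M`, so minimality passes on.
  minimal-below : ∀ 𝒜 T → ∃[ S ] S Prop.∈ (T ∷ 𝒜) × Minimal A (T ∷ 𝒜) S × A [ S ⊆ T ]
  minimal-below []      T = T , here refl , (λ T⊆T → T⊆T) ∷ [] , (λ x∈ → x∈)
  minimal-below (S ∷ 𝒜) T with minimal-below 𝒜 T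
  ... | M , M∈ , minT ∷ min𝒜 , M⊆T with S ⊆? M
  ...   | yes S⊆M = S , there (here refl)
    , below minT ∷ (λ S⊆S → S⊆S) ∷ All.map below min𝒜 , (λ x∈ → M⊆T (S⊆M x∈))
    where
    below : ∀ {R} → (A [ R ⊆ M ] → A [ M ⊆ R ]) → A [ R ⊆ S ] → A [ S ⊆ R ]
    below min R⊆S x∈ = min (λ y∈ → S⊆M (R⊆S y∈)) (S⊆M x∈)
  ...   | no  S⊈M = M , insert M∈
    , minT ∷ (λ S⊆M → ⊥-elim (S⊈M S⊆M)) ∷ min𝒜 , M⊆T
    where
    insert : M Prop.∈ (T ∷ 𝒜) → M Prop.∈ (T ∷ S ∷ 𝒜)
    insert (here refl) = here refl
    insert (there M∈)  = there (there M∈)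

  ∈-minimals⁺ : ∀ {𝒜 S} → 𝒫 A [ S ∈ 𝒜 ] → Minimal A 𝒜 S → 𝒫 A [ S ∈ minimals A 𝒜 ]
  ∈-minimals⁺ {𝒜} = Membershipₚ.∈-filter⁺ ∣ 𝒫 A ∣ₛ (minimal? A 𝒜)
    λ {S} {S′} S≈S′ → All.map (respect S≈S′)
    where
    respect : ∀ {S S′} → S 𝒫A.≈ S′ → ∀ {T} →
      (A [ T ⊆ S ] → A [ S ⊆ T ]) → A [ T ⊆ S′ ] → A [ S′ ⊆ T ]
    respect (_ , S′⊆S) min T⊆S′ x∈ = min (λ y∈ → S′⊆S (T⊆S′ y∈)) (S′⊆S x∈)

  minimals-⊆ : ∀ {𝒜 S} → 𝒫 A [ S ∈ minimals A 𝒜 ] → 𝒫 A [ S ∈ 𝒜 ]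
  minimals-⊆ {𝒜} = Subsetₚ.filter-⊆ ∣ 𝒫 A ∣ₛ (minimal? A 𝒜) 𝒜

  minimals-below : ∀ {𝒜 T} → 𝒫 A [ T ∈ 𝒜 ] →
    ∃[ S ] 𝒫 A [ S ∈ minimals A 𝒜 ] × A [ S ⊆ T ]
  minimals-below {𝒜} {T} T∈ with minimal-below 𝒜 T
  ... | S , S∈ , _ ∷ min , S⊆T = S , ∈-minimals⁺ (S∈𝒜 S∈) min , S⊆T
    where
    S∈𝒜 : ∀ {S} → S Prop.∈ (T ∷ 𝒜) → 𝒫 A [ S ∈ 𝒜 ]
    S∈𝒜 (here refl) = T∈
    S∈𝒜 (there S∈)  = Any.map 𝒫A.reflexive S∈

  minimals-sperner : ∀ {𝒜} → Sperner A 𝒜 → minimals A 𝒜 ≡ 𝒜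
  minimals-sperner {𝒜} sp = filter-all (minimal? A 𝒜)
    (All.tabulate λ S∈ → All.tabulate λ T∈ T⊆S →
      proj₂ (sp (Any.map 𝒫A.reflexive T∈) (Any.map 𝒫A.reflexive S∈) T⊆S))

  sperner-resp : ∀ {𝒜 ℬ} → DecSetoid._≈_ (𝒫 (𝒫 A)) 𝒜 ℬ → Sperner A 𝒜 → Sperner A ℬ
  sperner-resp (_ , ℬ⊆𝒜) sp S∈ T∈ = sp (ℬ⊆𝒜 S∈) (ℬ⊆𝒜 T∈)

module _ (A : DSet) (I : List (DecSetoid.Carrier A)) where
  private
    Q = Quotient A I
    module 𝒫Q = DecSetoid (𝒫 Q)

  collapse-cong : ∀ {𝒜 ℬ} → DecSetoid._≈_ (𝒫 (𝒫 A)) 𝒜 ℬ →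
    DecSetoid._≈_ (𝒫 (𝒫 Q)) (collapse A I 𝒜) (collapse A I ℬ)
  collapse-cong = image-cong (𝒫 A) (𝒫 Q) (map (proj A I)) (image-cong A Q (proj A I) inj₁)

  -- Recognition looks at the construction of a card only through this lemma and `card-block-below`.
  card-block⁻ : ∀ {𝒜 S} → 𝒫 Q [ S ∈ proj₂ (cardSystem A 𝒜 I) ] →
    ∃[ T ] 𝒫 A [ T ∈ 𝒜 ] × T 𝒫Q.≈ S
  card-block⁻ S∈ with Membershipₚ.∈-map⁻ ∣ 𝒫 A ∣ₛ ∣ 𝒫 Q ∣ₛ (minimals-⊆ Q S∈)
  -- `proj` is the identity on carriers, so the image of `T` is the list `T` itself, read modulo
  -- `θ`.
  ... | T , T∈ , S≈T = T , T∈ , ≡.subst (𝒫Q._≈ _) (map-id T) (𝒫Q.sym S≈T)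

  card-block-below : ∀ {𝒜 T} → 𝒫 A [ T ∈ 𝒜 ] →
    ∃[ S ] 𝒫 Q [ S ∈ proj₂ (cardSystem A 𝒜 I) ] × Q [ S ⊆ T ]
  card-block-below {𝒜} {T} T∈
    with minimals-below Q (Membershipₚ.∈-map⁺ ∣ 𝒫 A ∣ₛ ∣ 𝒫 Q ∣ₛ
                            (image-cong A Q (proj A I) inj₁) T∈)
  ... | S , S∈ , S⊆T = S , S∈ , ≡.subst (λ R → Q [ S ⊆ R ]) (map-id T) S⊆T

-- Keeps from the permutation only which isomorphism types occur.
deck-⊆ : (A B : FiniteSet) {𝒜 : SetSystem (set A)} {ℬ : SetSystem (set B)} →
  SameDeck A B 𝒜 ℬ → ∀ {I} → I Prop.∈ twoElementSubsets A →
  ∃[ J ] J Prop.∈ twoElementSubsets B × cardSystem (set A) 𝒜 I ≅ cardSystem (set B) ℬ J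
deck-⊆ A B {𝒜} {ℬ} same {I} I∈ = Prop.find (Anyₚ.map⁻
  (Permutationₚ.∈-resp-↭ isoTypes {cardSystem (set A) 𝒜 I} same
    (Membershipₚ.∈-map⁺ (≡ₚ.setoid _) isoTypes
      (λ { {J} refl → ≅-refl {cardSystem (set A) 𝒜 J} }) I∈)))

-- Systems determined by a subset of the ground set

-- `shape` is polymorphic so that the same list serves over `A` and over every quotient. `sperner`
-- ensures that taking minimal blocks changes nothing, and `injective` lets an isomorphism of cards
-- be turned into an equality of sizes.
record Shape : Set₁ where
  field
    shape     : {X : Set} → List X → List (List X)
    natural   : {X Y : Set} (f : X → Y) (U : List X) → map (map f) (shape U) ≡ shape (map f U)
    cong      : (A : DSet) → ∀ {U V} →
      DecSetoid._≈_ (𝒫 A) U V → DecSetoid._≈_ (𝒫 (𝒫 A)) (shape U) (shape V)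
    injective : (A : DSet) → ∀ {U V} →
      DecSetoid._≈_ (𝒫 (𝒫 A)) (shape U) (shape V) → DecSetoid._≈_ (𝒫 A) U V
    sperner   : (A : DSet) → ∀ U → Sperner A (shape U)

  HasShape : System → Set
  HasShape (A , 𝒜) = ∃[ U ] DecSetoid._≈_ (𝒫 (𝒫 A)) 𝒜 (shape U)

  Recognisable : Set₁
  Recognisable = (B : FiniteSet) (ℬ : SetSystem (set B)) → Sperner (set B) ℬ → 4 ≤ size B →
    (∀ {I} → I Prop.∈ twoElementSubsets B → HasShape (cardSystem (set B) ℬ I)) →
    HasShape (set B , ℬ)

  -- Collapsing does not change the underlying lists, and a system of this shape is Sperner over the
  -- quotient too, so `minimals` keeps every block.
  card-shape : (A : DSet) → ∀ {𝒜 U} I → DecSetoid._≈_ (𝒫 (𝒫 A)) 𝒜 (shape U) →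
    DecSetoid._≈_ (𝒫 (𝒫 (Quotient A I))) (proj₂ (cardSystem A 𝒜 I)) (shape U)
  card-shape A {𝒜} {U} I 𝒜≈U = ≡.subst (𝒫²Q._≈ shape U)
    (≡.sym (minimals-sperner Q (sperner-resp Q (𝒫²Q.sym 𝒞≈U) (sperner Q U)))) 𝒞≈U
    where
    Q = Quotient A I
    module 𝒫²Q = DecSetoid (𝒫 (𝒫 Q))

    𝒞≈U : collapse A I 𝒜 𝒫²Q.≈ shape U
    𝒞≈U = ≡.subst (collapse A I 𝒜 𝒫²Q.≈_) (≡.trans (natural id U) (≡.cong shape (map-id U)))
      (collapse-cong A I 𝒜≈U)

  ≅-shape : (X Y : System) (X≅Y : X ≅ Y) → ∀ {U} →
    DecSetoid._≈_ (𝒫 (𝒫 (proj₁ X))) (proj₂ X) (shape U) →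
    DecSetoid._≈_ (𝒫 (𝒫 (proj₁ Y))) (proj₂ Y) (shape (map (Inverse.to (proj₁ X≅Y)) U))
  ≅-shape (A , 𝒜) (B , ℬ) (σ , σ𝒜≈ℬ) {U} 𝒜≈U = 𝒫²B.trans (𝒫²B.sym σ𝒜≈ℬ)
    (≡.subst (map (map (Inverse.to σ)) 𝒜 𝒫²B.≈_) (natural (Inverse.to σ) U)
      (image²-cong A B σ 𝒜≈U))
    where module 𝒫²B = DecSetoid (𝒫 (𝒫 B))

  -- Isomorphic cards have underlying subsets of the same size, so `card-≮`, used in both
  -- directions, equates the sizes of `U` and `V`; `extend` then provides the bijection.
  same-deck-≅ : (A B : FiniteSet) {𝒜 : SetSystem (set A)} {ℬ : SetSystem (set B)} →
    4 ≤ size A → size A ≡ size B →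
    ∀ {U V} → DecSetoid._≈_ (𝒫 (𝒫 (set A))) 𝒜 (shape U) →
    DecSetoid._≈_ (𝒫 (𝒫 (set B))) ℬ (shape V) →
    (∀ {I} → I Prop.∈ twoElementSubsets A → ∃[ J ] J Prop.∈ twoElementSubsets B ×
      cardSystem (set A) 𝒜 I ≅ cardSystem (set B) ℬ J) →
    (∀ {J} → J Prop.∈ twoElementSubsets B → ∃[ I ] I Prop.∈ twoElementSubsets A ×
      cardSystem (set B) ℬ J ≅ cardSystem (set A) 𝒜 I) →
    (set A , 𝒜) ≅ (set B , ℬ)
  same-deck-≅ A B {𝒜} {ℬ} 4≤|A| |A|≡|B| {U} {V} 𝒜≈U ℬ≈V A→B B→A =
    σ , 𝒫²B.trans
      (≡.subst (map (map (Inverse.to σ)) 𝒜 𝒫²B.≈_) (natural (Inverse.to σ) U)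
        (image²-cong (set A) (set B) σ 𝒜≈U))
      (𝒫²B.trans (cong (set B) (extend-image A B |A|≡|B| {U} {V} |U|≡|V|)) (𝒫²B.sym ℬ≈V))
    where
    module 𝒫²B = DecSetoid (𝒫 (𝒫 (set B)))

    card-≡ : ∀ I J → cardSystem (set A) 𝒜 I ≅ cardSystem (set B) ℬ J →
      card (Quotient (set A) I) U ≡ card (Quotient (set B) J) V
    card-≡ I J I≅J = ≅-card QI QJ (proj₁ I≅J) {U} {V} (injective QJ
      (DecSetoid.trans (𝒫 (𝒫 QJ))
        (DecSetoid.sym (𝒫 (𝒫 QJ))
          (≅-shape (cardSystem (set A) 𝒜 I) (cardSystem (set B) ℬ J) I≅J
            (card-shape (set A) I 𝒜≈U)))
        (card-shape (set B) J ℬ≈V)))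
      where
      QI = Quotient (set A) I
      QJ = Quotient (set B) J

    A→B-card : ∀ {I} → I Prop.∈ twoElementSubsets A → ∃[ J ] J Prop.∈ twoElementSubsets B ×
      card (Quotient (set A) I) U ≡ card (Quotient (set B) J) V
    A→B-card {I} I∈ = let J , J∈ , I≅J = A→B I∈ in J , J∈ , card-≡ I J I≅J

    B→A-card : ∀ {J} → J Prop.∈ twoElementSubsets B → ∃[ I ] I Prop.∈ twoElementSubsets A ×
      card (Quotient (set A) I) U ≡ card (Quotient (set B) J) V
    B→A-card {J} J∈ = let I , I∈ , J≅I = B→A J∈ in
      I , I∈ , card-≡ I J (≅-sym {cardSystem (set B) ℬ J} {cardSystem (set A) 𝒜 I} J≅I)

    |U|≡|V| : card (set A) U ≡ card (set B) V
    |U|≡|V| = ℕ.≤-antisym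
      (ℕ.≮⇒≥ (card-≮ B A {V} {U} 4≤|A|
        (λ J∈ → let I , I∈ , eq = B→A-card J∈ in I , I∈ , ≡.sym eq)
        (λ I∈ → let J , J∈ , eq = A→B-card I∈ in J , J∈ , ≡.sym eq)))
      (ℕ.≮⇒≥ (card-≮ A B {U} {V} (≡.subst (4 ≤_) |A|≡|B| 4≤|A|) A→B-card B→A-card))

    σ = extend A B |A|≡|B| {U} {V} |U|≡|V|

  -- Each card of `ℬ` is isomorphic to a card of `𝒜` and so inherits the shape; recognition passes
  -- the shape on to `ℬ`.
  reconstructible : Recognisable → ∀ A {𝒜} → 4 ≤ size A → HasShape (set A , 𝒜) →
    Reconstructible A 𝒜
  reconstructible recognise A {𝒜} 4≤|A| (U , 𝒜≈U) B ℬ (ℬ-sperner , |B|≡|A| , same) =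
    same-deck-≅ A B 4≤|A| (≡.sym |B|≡|A|) 𝒜≈U (proj₂ ℬ-shape)
      (deck-⊆ A B {𝒜} {ℬ} (Permutation.↭-sym isoTypes same)) B→A
    where
    B→A = deck-⊆ B A {ℬ} {𝒜} same

    ℬ-shape : HasShape (set B , ℬ)
    ℬ-shape = recognise B ℬ ℬ-sperner (≡.subst (4 ≤_) (≡.sym |B|≡|A|) 4≤|A|) λ {J} J∈ →
      let I , _ , J≅I = B→A J∈ in
      _ , ≅-shape (cardSystem (set A) 𝒜 I) (cardSystem (set B) ℬ J)
            (≅-sym {cardSystem (set B) ℬ J} {cardSystem (set A) 𝒜 I} J≅I)
            (card-shape (set A) I 𝒜≈U)

-- The two shapes: one block, and singletons

∈-[-]⁻ : ∀ A {x y} → A [ x ∈ [ y ] ] → DecSetoid._≈_ A x y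
∈-[-]⁻ A (here x≈y) = x≈y

oneBlock : Shape
oneBlock = record
  { shape     = [_]
  ; natural   = λ _ _ → refl
  ; cong      = λ A U≈V → (λ { (here S≈U) → here (trans (𝒫 A) S≈U U≈V) })
                        , (λ { (here S≈V) → here (trans (𝒫 A) S≈V (sym (𝒫 A) U≈V)) })
  ; injective = λ A {U} → λ (U∈ , _) → ∈-[-]⁻ (𝒫 A) (U∈ (here (DecSetoid.refl (𝒫 A) {U})))
  ; sperner   = λ A U → λ { {S} {T} (here S≈U) (here T≈U) _ →
      trans (𝒫 A) {S} {U} {T} S≈U (sym (𝒫 A) {T} {U} T≈U) }
  }
  where open DecSetoid using (trans; sym)

module _ (A : DSet) where
  open DecSetoid A renaming (refl to ≈-refl; sym to ≈-sym; trans to ≈-trans)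
  private module 𝒫A = DecSetoid (𝒫 A)

  singleton-cong : ∀ {x y} → x ≈ y → [ x ] 𝒫A.≈ [ y ]
  singleton-cong x≈y = (λ { (here z≈x) → here (≈-trans z≈x x≈y) })
                     , (λ { (here z≈y) → here (≈-trans z≈y (≈-sym x≈y)) })

  singleton-⊆⁻ : ∀ {x y} → A [ [ x ] ⊆ [ y ] ] → x ≈ y
  singleton-⊆⁻ x⊆y with here x≈y ← x⊆y (here ≈-refl) = x≈y

  ∈-singletons⁺ : ∀ {x U} → A [ x ∈ U ] → 𝒫 A [ [ x ] ∈ map [_] U ]
  ∈-singletons⁺ = Membershipₚ.∈-map⁺ ∣ A ∣ₛ ∣ 𝒫 A ∣ₛ singleton-cong

  ∈-singletons⁻ : ∀ {S U} → 𝒫 A [ S ∈ map [_] U ] → ∃[ x ] A [ x ∈ U ] × S 𝒫A.≈ [ x ]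
  ∈-singletons⁻ = Membershipₚ.∈-map⁻ ∣ A ∣ₛ ∣ 𝒫 A ∣ₛ

  singletons-mono : ∀ {U V} → A [ U ⊆ V ] → 𝒫 A [ map [_] U ⊆ map [_] V ]
  singletons-mono U⊆V S∈ = let x , x∈ , S≈x = ∈-singletons⁻ S∈ in
    Membershipₚ.∈-resp-≈ ∣ 𝒫 A ∣ₛ (𝒫A.sym S≈x) (∈-singletons⁺ (U⊆V x∈))

  singletons-reflects-⊆ : ∀ {U V} → 𝒫 A [ map [_] U ⊆ map [_] V ] → A [ U ⊆ V ]
  singletons-reflects-⊆ U⊆V x∈ = let y , y∈ , x⊆y , _ = ∈-singletons⁻ (U⊆V (∈-singletons⁺ x∈)) in
    Membershipₚ.∈-resp-≈ ∣ A ∣ₛ (≈-sym (singleton-⊆⁻ x⊆y)) y∈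

  singletons-sperner : ∀ U → Sperner A (map [_] U)
  singletons-sperner U {S} {T} S∈ T∈ S⊆T with ∈-singletons⁻ {S} S∈ | ∈-singletons⁻ {T} T∈
  ... | x , _ , S≈x | y , _ , T≈y =
    𝒫A.trans {S} {[ x ]} {T} S≈x (𝒫A.trans {[ x ]} {[ y ]} {T}
      (singleton-cong (singleton-⊆⁻ λ z∈ → proj₁ T≈y (S⊆T (proj₂ S≈x z∈))))
      (𝒫A.sym {T} {[ y ]} T≈y))

  -- The subset is the union of the blocks: a point of the union lies in some block, and that block,
  -- being a singleton, consists of this point.
  all-singletons : ∀ {𝒜} → (∀ {S} → 𝒫 A [ S ∈ 𝒜 ] → ∃[ x ] S 𝒫A.≈ [ x ]) →
    DecSetoid._≈_ (𝒫 (𝒫 A)) 𝒜 (map [_] (concat 𝒜))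
  all-singletons {𝒜} single = ⊆-singletons , singletons-⊆
    where
    ⊆-singletons : 𝒫 A [ 𝒜 ⊆ map [_] (concat 𝒜) ]
    ⊆-singletons S∈ = let x , S≈x = single S∈ in
      Membershipₚ.∈-resp-≈ ∣ 𝒫 A ∣ₛ (𝒫A.sym S≈x)
        (∈-singletons⁺ (Membershipₚ.∈-concat⁺ ∣ A ∣ₛ
          (Any.map (λ S≈T → proj₁ S≈T (proj₂ S≈x (here ≈-refl))) S∈)))

    singletons-⊆ : 𝒫 A [ map [_] (concat 𝒜) ⊆ 𝒜 ]
    singletons-⊆ S∈ with ∈-singletons⁻ S∈
    ... | x , x∈ , S≈x with Membership.find ∣ 𝒫 A ∣ₛ (Membershipₚ.∈-concat⁻ ∣ A ∣ₛ 𝒜 x∈)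
    ... | T , T∈ , x∈T with single T∈
    ... | y , T≈y with here x≈y ← proj₁ T≈y x∈T =
      Membershipₚ.∈-resp-≈ ∣ 𝒫 A ∣ₛ
        (𝒫A.trans T≈y (𝒫A.trans (singleton-cong (≈-sym x≈y)) (𝒫A.sym S≈x))) T∈

singletons : Shape
singletons = record
  { shape     = map [_]
  ; natural   = λ f U → ≡.trans (≡.sym (map-∘ U)) (map-∘ U)
  ; cong      = λ A (U⊆V , V⊆U) → singletons-mono A U⊆V , singletons-mono A V⊆U
  ; injective = λ A (U⊆V , V⊆U) → singletons-reflects-⊆ A U⊆V , singletons-reflects-⊆ A V⊆U
  ; sperner   = singletons-sperner
  }

-- Recognising the shape from the cards

module _ (B : FiniteSet) (ℬ : SetSystem (set B)) (ℬ-sperner : Sperner (set B) ℬ)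
         (4≤|B| : 4 ≤ size B) where
  open DecSetoid (set B) using (_≈_) renaming (sym to ≈-sym)
  open DecMembership (set B) using (_∈?_)
  open DecSubset (set B) using (_⊆?_)
  private
    module 𝒫B = DecSetoid (𝒫 (set B))
    resp : ∀ {S x y} → x ≈ y → set B [ x ∈ S ] → set B [ y ∈ S ]
    resp = Membershipₚ.∈-resp-≈ ∣ set B ∣ₛ

  -- The bound 4 is what leaves room for `d` outside the three-entry list of `c`, `x` and `y`.
  pair-avoiding : ∀ x y → ∃[ c ] ∃[ d ] ¬ c ≈ d ×
    ¬ set B [ c ∈ x ∷ y ∷ [] ] × ¬ set B [ d ∈ x ∷ y ∷ [] ]
  pair-avoiding x y =
    let c , c∉ = outside B (x ∷ y ∷ []) (ℕ.≤-trans (s≤s (s≤s (s≤s z≤n))) 4≤|B|)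
        d , d∉ = outside B (c ∷ x ∷ y ∷ []) 4≤|B|
    in c , d , (λ c≈d → d∉ (here (≈-sym c≈d))) , c∉ , (λ d∈ → d∉ (there d∈))

  misses : ∀ {S I c d} → IsPair (set B) I c d → ¬ set B [ c ∈ S ] → ¬ set B [ d ∈ S ] →
    ∀ {x} → set B [ x ∈ S ] → ¬ set B [ x ∈ I ]
  misses I-pair c∉ d∉ x∈S x∈I =
    Sum.[ (λ x≈c → c∉ (resp x≈c x∈S)) , (λ x≈d → d∉ (resp x≈d x∈S)) ]′ (IsPair.only I-pair x∈I)

  some-pair : ∃[ I ] I Prop.∈ twoElementSubsets B
  some-pair =
    let x , _ = outside B [] (ℕ.≤-trans (s≤s z≤n) 4≤|B|)
        _ , _ , c≉d , _ = pair-avoiding x x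
        I , I∈ , _ = pair-of B c≉d
    in I , I∈

  -- Cards made of singletons

  module _ (cards : ∀ {I} → I Prop.∈ twoElementSubsets B →
              Shape.HasShape singletons (cardSystem (set B) ℬ I)) where

    thin-block-below : ∀ {T I} → 𝒫 (set B) [ T ∈ ℬ ] → I Prop.∈ twoElementSubsets B →
      ∃[ S ] 𝒫 (set B) [ S ∈ ℬ ] × Quotient (set B) I [ S ⊆ T ] ×
      ∃[ x ] DecSetoid._≈_ (𝒫 (Quotient (set B) I)) S [ x ]
    thin-block-below {T} {I} T∈ I∈ =
      let W , (cards⊆W , _) = cards I∈
          R , R∈ , R⊆T = card-block-below (set B) I T∈
          S , S∈ , S≈R = card-block⁻ (set B) I R∈
          x , _ , R≈x = ∈-singletons⁻ (Quotient (set B) I) (cards⊆W R∈)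
      in S , S∈ , (λ s∈ → R⊆T (proj₁ S≈R s∈)) , x
        , DecSetoid.trans (𝒫 (Quotient (set B) I)) S≈R R≈x

    -- Rules out the empty block: in any card, a singleton lies below the image of `T`.
    block-nonempty : ∀ {T} → 𝒫 (set B) [ T ∈ ℬ ] → ∃[ t ] set B [ t ∈ T ]
    block-nonempty T∈ =
      let I , I∈ = some-pair
          S , _ , S⊆T , x , _ , x⊆S = thin-block-below T∈ I∈
          t , t∈ , _ = ∈-quotient⁻ (set B) (S⊆T (x⊆S (here (DecSetoid.refl (Quotient (set B) I)))))
      in t , t∈

    -- `saturated` says that `T` contains or avoids `I`. Then the inclusion of `S` in `T` modulo `θ`
    -- lifts, the Sperner property makes them equal, and `T` lies in a single class.
    thin-block : ∀ {T I} → 𝒫 (set B) [ T ∈ ℬ ] → I Prop.∈ twoElementSubsets B →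
      (∀ {s t} → set B [ s ∈ I ] → set B [ t ∈ T ] → set B [ t ∈ I ] → set B [ s ∈ T ]) →
      ∀ {t u} → set B [ t ∈ T ] → set B [ u ∈ T ] → θ (set B) I t u
    thin-block {T} {I} T∈ I∈ saturated t∈ u∈ =
      let S , S∈ , S⊆T , x , S⊆x , _ = thin-block-below T∈ I∈
          _ , T⊆S = ℬ-sperner S∈ T∈ (lift-⊆ (set B) (λ _ → saturated) S⊆T)
          ~x = λ {v} (v∈ : set B [ v ∈ T ]) → ∈-[-]⁻ Q (S⊆x (project-∈ (set B) (T⊆S v∈)))
      in DecSetoid.trans Q (~x t∈) (DecSetoid.sym Q (~x u∈))
      where Q = Quotient (set B) I

    thin-block-pair : ∀ {T I t u} → 𝒫 (set B) [ T ∈ ℬ ] → I Prop.∈ twoElementSubsets B →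
      IsPair (set B) I t u → set B [ t ∈ T ] → set B [ u ∈ T ] →
      set B [ T ⊆ t ∷ u ∷ [] ]
    thin-block-pair {T} {I} {t} {u} T∈ I∈ I-pair t∈ u∈ x∈ =
      Sum.[ here , (λ (x∈I , _) → I⊆tu x∈I) ]′ (thin-block T∈ I∈ (λ s∈I _ _ → I⊆T s∈I) x∈ t∈)
      where
      open IsPair I-pair

      I⊆tu : set B [ I ⊆ t ∷ u ∷ [] ]
      I⊆tu x∈I = Sum.[ here , (λ x≈u → there (here x≈u)) ]′ (only x∈I)

      I⊆T : ∀ {s} → set B [ s ∈ I ] → set B [ s ∈ T ]
      I⊆T s∈I = Sum.[ (λ s≈t → resp (≈-sym s≈t) t∈) , (λ s≈u → resp (≈-sym s≈u) u∈) ]′ (only s∈I)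

    -- `T` lies in one class and avoids `I`, and the classes off `I` are single points.
    thin-block-disjoint : ∀ {T I c d} → 𝒫 (set B) [ T ∈ ℬ ] → I Prop.∈ twoElementSubsets B →
      IsPair (set B) I c d → ¬ set B [ c ∈ T ] → ¬ set B [ d ∈ T ] →
      ∀ {t u} → set B [ t ∈ T ] → set B [ u ∈ T ] → t ≈ u
    thin-block-disjoint {T} {I} T∈ I∈ I-pair c∉ d∉ t∈ u∈ =
      Sum.[ id , (λ (t∈I , _) → ⊥-elim (T∩I t∈ t∈I)) ]′
        (thin-block T∈ I∈ (λ _ s∈T s∈I → ⊥-elim (T∩I s∈T s∈I)) t∈ u∈)
      where
      T∩I : ∀ {x} → set B [ x ∈ T ] → ¬ set B [ x ∈ I ]
      T∩I = misses I-pair c∉ d∉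

    block-singleton : ∀ {T} → 𝒫 (set B) [ T ∈ ℬ ] → ∃[ t ] T 𝒫B.≈ [ t ]
    block-singleton {T} T∈ =
      let t , t∈ = block-nonempty T∈
      in t , decidable-stable (T ⊆? [ t ]) (λ T⊈t →
               let u , u∈ , u∉t = ⊈-witness (set B) T⊈t
                   I , I∈ , I-pair = pair-of B (λ t≈u → u∉t (here (≈-sym t≈u)))
                   T⊆tu = thin-block-pair T∈ I∈ I-pair t∈ u∈
                   -- `T` is by now confined to `t` and `u`, so a pair avoiding these two points is
                   -- disjoint from `T`.
                   c , d , c≉d , c∉ , d∉ = pair-avoiding t u
                   J , J∈ , J-pair = pair-of B c≉d
               in u∉t (here (thin-block-disjoint T∈ J∈ J-pair
                    (λ c∈ → c∉ (T⊆tu c∈)) (λ d∈ → d∉ (T⊆tu d∈)) u∈ t∈)))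
           , λ x∈ → resp (≈-sym (∈-[-]⁻ (set B) x∈)) t∈

  -- Cards made of one block

  module _ (cards : ∀ {I} → I Prop.∈ twoElementSubsets B →
              Shape.HasShape oneBlock (cardSystem (set B) ℬ I)) where

    -- The only block `W` of the card lies below the image of every block; `M` is a block whose
    -- image is `W`.
    least-block : ∀ {I} → I Prop.∈ twoElementSubsets B →
      ∃[ M ] 𝒫 (set B) [ M ∈ ℬ ] ×
      (∀ {T} → 𝒫 (set B) [ T ∈ ℬ ] → Quotient (set B) I [ M ⊆ T ])
    least-block {I} I∈ =
      let W , cards⊆W , W⊆cards = cards I∈
          M , M∈ , M⊆W , _ = card-block⁻ (set B) I (W⊆cards (here (DecSetoid.refl (𝒫 Q) {W})))
      in M , M∈ , λ T∈ m∈ →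
        let S , S∈ , S⊆T = card-block-below (set B) I T∈
        in S⊆T (proj₂ (∈-[-]⁻ (𝒫 Q) (cards⊆W S∈)) (M⊆W m∈))
      where Q = Quotient (set B) I

    -- For the pair of `c` and `d`, the least block `M` lifts into `S`, which avoids the pair, so
    -- `M` is `S`. Then `M` avoids the pair as well, and its inclusion in `T` lifts.
    avoiding⇒⊆ : ∀ {S T c d} → 𝒫 (set B) [ S ∈ ℬ ] → 𝒫 (set B) [ T ∈ ℬ ] →
      ¬ c ≈ d → ¬ set B [ c ∈ S ] → ¬ set B [ d ∈ S ] → set B [ S ⊆ T ]
    avoiding⇒⊆ {S} {T} {c} {d} S∈ T∈ c≉d c∉ d∉ s∈ =
      let I , I∈ , I-pair = pair-of B c≉d
          M , M∈ , M⊆ = least-block I∈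
          S∩I = λ {x} → misses I-pair c∉ d∉ {x}
          M⊆S , S⊆M = ℬ-sperner M∈ S∈
            (lift-⊆ (set B) (λ _ _ t∈S t∈I → ⊥-elim (S∩I t∈S t∈I)) (M⊆ S∈))
      in lift-⊆ (set B) (λ m∈ m∈I _ _ → ⊥-elim (S∩I (M⊆S m∈) m∈I)) (M⊆ T∈) (S⊆M s∈)

    -- Here both lifts work because the larger sets, `S` and then `T`, contain the whole pair.
    containing⇒⊆ : ∀ {S T c d} → 𝒫 (set B) [ S ∈ ℬ ] → 𝒫 (set B) [ T ∈ ℬ ] → ¬ c ≈ d →
      set B [ c ∈ S ] → set B [ d ∈ S ] → set B [ c ∈ T ] → set B [ d ∈ T ] → set B [ S ⊆ T ]
    containing⇒⊆ {S} {T} {c} {d} S∈ T∈ c≉d c∈S d∈S c∈T d∈T s∈ =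
      let I , I∈ , I-pair = pair-of B c≉d
          M , M∈ , M⊆ = least-block I∈
          _ , S⊆M = ℬ-sperner M∈ S∈
            (lift-⊆ (set B) (λ _ m∈I _ _ → contains I-pair c∈S d∈S m∈I) (M⊆ S∈))
      in lift-⊆ (set B) (λ _ m∈I _ _ → contains I-pair c∈T d∈T m∈I) (M⊆ T∈) (S⊆M s∈)
      where
      contains : ∀ {I R} → IsPair (set B) I c d → set B [ c ∈ R ] → set B [ d ∈ R ] →
        ∀ {x} → set B [ x ∈ I ] → set B [ x ∈ R ]
      contains I-pair c∈ d∈ x∈ =
        Sum.[ (λ x≈c → resp (≈-sym x≈c) c∈) , (λ x≈d → resp (≈-sym x≈d) d∈) ]′
          (IsPair.only I-pair x∈)

    blocks-⊆ : ∀ {S T} → 𝒫 (set B) [ S ∈ ℬ ] → 𝒫 (set B) [ T ∈ ℬ ] → set B [ S ⊆ T ]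
    blocks-⊆ {S} {T} S∈ T∈ = decidable-stable (S ⊆? T) λ S⊈T →
      -- If the inclusion fails, neither block contains the other. It will follow that `S` misses
      -- only `b` and `T` misses only `a`, so `c` and `d` lie in both.
      let a , _ , a∉T = ⊈-witness (set B) S⊈T
          b , _ , b∉S = ⊈-witness (set B) {T} {S}
            (λ T⊆S → S⊈T (proj₂ (ℬ-sperner T∈ S∈ T⊆S)))
          c , d , c≉d , c∉ , d∉ = pair-avoiding a b
      in S⊈T (containing⇒⊆ S∈ T∈ c≉d (in-S S⊈T b∉S c∉) (in-S S⊈T b∉S d∉)
                                     (in-T S⊈T a∉T c∉) (in-T S⊈T a∉T d∉))
      where
      in-S : ¬ set B [ S ⊆ T ] → ∀ {a b x} → ¬ set B [ b ∈ S ] →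
        ¬ set B [ x ∈ a ∷ b ∷ [] ] → set B [ x ∈ S ]
      -- A second point missed by `S` would form with `b` a pair avoiding `S`, which forces `S` into
      -- `T`.
      in-S S⊈T {x = x} b∉S x∉ = decidable-stable (x ∈? S) λ x∉S →
        S⊈T (avoiding⇒⊆ S∈ T∈ (λ x≈b → x∉ (there (here x≈b))) x∉S b∉S)

      in-T : ¬ set B [ S ⊆ T ] → ∀ {a b x} → ¬ set B [ a ∈ T ] →
        ¬ set B [ x ∈ a ∷ b ∷ [] ] → set B [ x ∈ T ]
      in-T S⊈T {x = x} a∉T x∉ = decidable-stable (x ∈? T) λ x∉T →
        S⊈T (proj₂ (ℬ-sperner T∈ S∈
          (avoiding⇒⊆ T∈ S∈ (λ x≈a → x∉ (here x≈a)) x∉T a∉T)))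

    single-block : Shape.HasShape oneBlock (set B , ℬ)
    single-block =
      -- Any pair will do: it only supplies the existence of a block, and all blocks are equal.
      let M , M∈ , _ = least-block (proj₂ some-pair)
      in M , (λ S∈ → here (blocks-⊆ S∈ M∈ , blocks-⊆ M∈ S∈))
           , (λ S∈ → Membershipₚ.∈-resp-≈ ∣ 𝒫 (set B) ∣ₛ (𝒫B.sym (∈-[-]⁻ (𝒫 (set B)) S∈)) M∈)

theorem4p10 : ∀ (n : ℕ) (𝒜 : SetSystem (set [1⋯ n ])) →
    Sperner (set [1⋯ n ]) 𝒜 →
    4 ≤ n →
    Homogeneous (set [1⋯ n ]) 1 𝒜 ⊎ card (𝒫 (set [1⋯ n ])) 𝒜 ≡ 1 →
    Reconstructible [1⋯ n ] 𝒜
theorem4p10 n 𝒜 _ 4≤n (inj₁ homogeneous) =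
  Shape.reconstructible singletons
    (λ B ℬ sp 4≤|B| cards → _ , all-singletons (set B) (block-singleton B ℬ sp 4≤|B| cards))
    [1⋯ n ] 4≤size
    (_ , all-singletons A (λ {S} S∈ → card-≡-1 A S (homogeneous S∈)))
  where
  A = set [1⋯ n ]
  -- The size is the length of a tabulated list, which has to be rewritten to `n`.
  4≤size = ≡.subst (4 ≤_) (≡.sym (length-tabulate {n = n} id)) 4≤n
theorem4p10 n 𝒜 _ 4≤n (inj₂ |𝒜|≡1) =
  Shape.reconstructible oneBlock single-block [1⋯ n ] 4≤size (card-≡-1 (𝒫 (set [1⋯ n ])) 𝒜 |𝒜|≡1)
  where
  4≤size = ≡.subst (4 ≤_) (≡.sym (length-tabulate {n = n} id)) 4≤n
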